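{- Let $n$ be a positive integer and $\mathbf b=(b_1,\dots,b_n)\in\mathbb Z_{>0}^n$, not with $n=1=b_1$. The polytope $\mathfrak X'_n(\mathbf b)$ is a polymatroid (namely the polymatroid associated with the submodular function $f_{\mathbf b}$). In fact, $\mathfrak X'_n(\mathbf b)$ is a special polymatroid for which the upper bounds $f_{\mathbf b}(I)$ on the sum of entries in any set $I\subseteq[n]$ depend only on the cardinality $|I|$.
   Context: Write $[n]=\{1,\dots,n\}$. A $\mathbf b$-parking function is a list $(\beta_1,\dots,\beta_n)$ of positive integers whose nondecreasing rearrangement satisfies $\beta'_i\le b_1+\cdots+b_i$ for all $i$, and $\mathfrak X_n(\mathbf b)\subset\mathbb R^n$ is the convex hull of all $\mathbf b$-parking functions. Define $f_{\mathbf b}:2^{[n]}\to\mathbb Z_{\ge 0}$ by $f_{\mathbf b}(\emptyset)=0$ and $f_{\mathbf b}(I)=-|I|+\sum_{j=1}^n\min\{|I|,j\}\,b_{n-j+1}$ for $\emptyset\ne I\subseteq[n]$. Define $$\mathfrak X'_n(\mathbf b)=\Big\{y\in\mathbb R^n: y\ge0,\ \sum_{i\in I}y_i\le f_{\mathbf b}(I)\text{ for all }I\subseteq[n]\Big\},$$ which arises from the inequality description of $\mathfrak X_n(\mathbf b)$ via the substitution $y_i=x_i-1$. A set function $f:2^{[n]}\to\mathbb R$ is submodular if $f(X\cup\{z\})-f(X)\ge f(Y\cup\{z\})-f(Y)$ for all $X\subseteq Y\subseteq[n]$ and $z\in[n]\setminus Y$. The polymatroid associated with a submodular $f$ is $P_f=\{x\in\mathbb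 R^n:x\ge0,\ \sum_{i\in S}x_i\le f(S)\text{ for all }S\subseteq[n]\}$. -}

module Defs where

open import Algebra.Bundles.Raw using (RawMonoid)
import Algebra.Definitions.RawMonoid as RawMonoidDefinitions
open import Data.Bool.Base using (if_then_else_)
open import Data.Fin.Base as Fin using (Fin; zero; suc; toℕ; opposite)
open import Data.Fin.Properties using (toℕ-fromℕ)
open import Data.Fin.Subset using (Subset; _∈_; _∉_; _⊆_; _∪_; ⁅_⁆; ∣_∣)
open import Data.Fin.Subset.Properties using (_∈?_; nonempty?; ∣p∣≤n)
open import Data.Integer.Base as ℤ using (ℤ; +_; 0ℤ)
import Data.Integer.Properties as ℤ
open import Data.Nat.Base as ℕ using (ℕ; zero; suc; _⊓_; _⊔_)
import Data.Nat.Properties as ℕ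
open import Data.Product.Base using (_×_; _,_; ∃-syntax)
open import Data.Rational.Base as ℚ using (ℚ; 0ℚ; ½)
import Data.Rational.Properties as ℚ
open import Data.Rational.Solver using (module +-*-Solver)
open import Data.Vec.Functional using (Vector)
open import Level using (0ℓ)
open import Relation.Binary.PropositionalEquality
open import Relation.Nullary.Decidable using (does; yes; no)
open import Relation.Unary using (Pred)

------------------------------------------------------------------------
-- Real numbers as Cauchy sequences of rationals, with equality and order
-- given by relations rather than by a quotient.

IsCauchy : (ℕ → ℚ) → Set
IsCauchy x = ∀ ε → 0ℚ ℚ.< ε →
  ∃[ N ] (∀ m n → N ℕ.≤ m → N ℕ.≤ n → ℚ.∣ x m ℚ.- x n ∣ ℚ.≤ ε)

record ℝ : Set where
  constructor mkℝ
  field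
    seq    : ℕ → ℚ
    cauchy : IsCauchy seq

open ℝ public

infix  4 _≤_ _≃_
infixl 6 _+_ _-_
infix  8 -_

-- The limit of x is at most the limit of y.
_≤_ : ℝ → ℝ → Set
x ≤ y = ∀ ε → 0ℚ ℚ.< ε → ∃[ N ] (∀ n → N ℕ.≤ n → seq x n ℚ.≤ seq y n ℚ.+ ε)

_≃_ : ℝ → ℝ → Set
x ≃ y = x ≤ y × y ≤ x

private
  half-pos : ∀ {ε} → 0ℚ ℚ.< ε → 0ℚ ℚ.< ½ ℚ.* ε
  half-pos {ε} 0<ε = subst (ℚ._< ½ ℚ.* ε) (ℚ.*-zeroʳ ½) (ℚ.*-monoʳ-<-pos ½ 0<ε)

  half+half : ∀ ε → ½ ℚ.* ε ℚ.+ ½ ℚ.* ε ≡ ε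
  half+half ε = trans (sym (ℚ.*-distribʳ-+ ε ½ ½)) (ℚ.*-identityˡ ε)

  interchange : ∀ a b c d → (a ℚ.+ b) ℚ.- (c ℚ.+ d) ≡ (a ℚ.- c) ℚ.+ (b ℚ.- d)
  interchange = solve 4 (λ a b c d → (a :+ b) :- (c :+ d) := (a :- c) :+ (b :- d)) refl
    where open +-*-Solver

_+_ : ℝ → ℝ → ℝ
seq (x + y) n = seq x n ℚ.+ seq y n
cauchy (x + y) ε 0<ε with cauchy x _ (half-pos 0<ε) | cauchy y _ (half-pos 0<ε)
... | M , p | N , q = M ⊔ N , λ m n M⊔N≤m M⊔N≤n → begin
  ℚ.∣ (seq x m ℚ.+ seq y m) ℚ.- (seq x n ℚ.+ seq y n) ∣
    ≡⟨ cong ℚ.∣_∣ (interchange (seq x m) (seq y m) (seq x n) (seq y n)) ⟩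
  ℚ.∣ (seq x m ℚ.- seq x n) ℚ.+ (seq y m ℚ.- seq y n) ∣
    ≤⟨ ℚ.∣p+q∣≤∣p∣+∣q∣ (seq x m ℚ.- seq x n) (seq y m ℚ.- seq y n) ⟩
  ℚ.∣ seq x m ℚ.- seq x n ∣ ℚ.+ ℚ.∣ seq y m ℚ.- seq y n ∣
    ≤⟨ ℚ.+-mono-≤ (p m n (ℕ.m⊔n≤o⇒m≤o M N M⊔N≤m) (ℕ.m⊔n≤o⇒m≤o M N M⊔N≤n))
                  (q m n (ℕ.m⊔n≤o⇒n≤o M N M⊔N≤m) (ℕ.m⊔n≤o⇒n≤o M N M⊔N≤n)) ⟩
  ½ ℚ.* ε ℚ.+ ½ ℚ.* ε
    ≡⟨ half+half ε ⟩
  ε ∎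
  where open ℚ.≤-Reasoning

-_ : ℝ → ℝ
seq (- x) n = ℚ.- seq x n
cauchy (- x) ε 0<ε with cauchy x ε 0<ε
... | N , p = N , λ m n N≤m N≤n → begin
  ℚ.∣ (ℚ.- seq x m) ℚ.- (ℚ.- seq x n) ∣
    ≡⟨ cong ℚ.∣_∣ (ℚ.neg-distrib-+ (seq x m) (ℚ.- seq x n)) ⟨
  ℚ.∣ ℚ.- (seq x m ℚ.- seq x n) ∣
    ≡⟨ ℚ.∣-p∣≡∣p∣ (seq x m ℚ.- seq x n) ⟩
  ℚ.∣ seq x m ℚ.- seq x n ∣
    ≤⟨ p m n N≤m N≤n ⟩
  ε ∎
  where open ℚ.≤-Reasoning

_-_ : ℝ → ℝ → ℝ
x - y = x + (- y)

fromℚ : ℚ → ℝ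
seq (fromℚ q) _ = q
cauchy (fromℚ q) ε 0<ε = 0 , λ _ _ _ _ →
  subst (λ r → ℚ.∣ r ∣ ℚ.≤ ε) (sym (ℚ.+-inverseʳ q)) (ℚ.<⇒≤ 0<ε)

fromℤ : ℤ → ℝ
fromℤ i = fromℚ (i ℚ./ 1)

0ℝ : ℝ
0ℝ = fromℤ 0ℤ

+-0-rawMonoid : RawMonoid 0ℓ 0ℓ
+-0-rawMonoid = record { Carrier = ℝ ; _≈_ = _≃_ ; _∙_ = _+_ ; ε = 0ℝ }

------------------------------------------------------------------------
-- Submodular functions and polymatroids

open RawMonoidDefinitions +-0-rawMonoid using () renaming (sum to sumℝ)
open RawMonoidDefinitions ℕ.+-0-rawMonoid using () renaming (sum to sumℕ)

sumOver : ∀ {n} → Subset n → Vector ℝ n → ℝ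
sumOver S x = sumℝ (λ i → if does (i ∈? S) then x i else 0ℝ)

Submodular : ∀ {n} → (Subset n → ℝ) → Set
Submodular {n} f = ∀ (X Y : Subset n) (z : Fin n) → X ⊆ Y → z ∉ Y →
  f (Y ∪ ⁅ z ⁆) - f Y ≤ f (X ∪ ⁅ z ⁆) - f X

polymatroid : ∀ {n} → (Subset n → ℝ) → Pred (Vector ℝ n) 0ℓ
polymatroid f x = (∀ i → 0ℝ ≤ x i) × (∀ S → sumOver S x ≤ f S)

------------------------------------------------------------------------
-- The set function f_b and the polytope 𝔛′_n(b)

-- Indices are shifted: b k stands for b_{k+1}.  The summation index k stands
-- for j = k+1, so that b_{n-j+1} is b (opposite k).
cap : ∀ {n} → Vector ℕ n → Subset n → ℤ
cap b I = if does (nonempty? I)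
  then ℤ.- (+ ∣ I ∣) ℤ.+ (+ sumℕ (λ k → (∣ I ∣ ⊓ suc (toℕ k)) ℕ.* b (opposite k)))
  else 0ℤ

𝔛′ : ∀ {n} → Vector ℕ n → Pred (Vector ℝ n) 0ℓ
𝔛′ b y = (∀ i → 0ℝ ≤ y i) × (∀ I → sumOver I y ≤ fromℤ (cap b I))

private
  term≤sum : ∀ {n} (t : Vector ℕ n) k → t k ℕ.≤ sumℕ t
  term≤sum t zero    = ℕ.m≤m+n _ _
  term≤sum t (suc k) = ℕ.≤-trans (term≤sum (λ i → t (suc i)) k) (ℕ.m≤n+m _ (t zero))

  size≤sum : ∀ {n} (b : Vector ℕ n) → (∀ i → 0 ℕ.< b i) → ∀ {m} → m ℕ.≤ n →
             m ℕ.≤ sumℕ (λ k → (m ⊓ suc (toℕ k)) ℕ.* b (opposite k))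
  size≤sum {zero}  b 0<b m≤n = m≤n
  size≤sum {suc n} b 0<b {m} m≤n = begin
    m
      ≡⟨ ℕ.m≤n⇒m⊓n≡m m≤n ⟨
    m ⊓ suc n
      ≡⟨ cong (λ l → m ⊓ suc l) (toℕ-fromℕ n) ⟨
    m ⊓ suc (toℕ last)
      ≤⟨ ℕ.m≤m*n _ (b (opposite last)) {{ℕ.>-nonZero (0<b (opposite last))}} ⟩
    (m ⊓ suc (toℕ last)) ℕ.* b (opposite last)
      ≤⟨ term≤sum (λ k → (m ⊓ suc (toℕ k)) ℕ.* b (opposite k)) last ⟩
    sumℕ (λ k → (m ⊓ suc (toℕ k)) ℕ.* b (opposite k)) ∎
    where
    open ℕ.≤-Reasoning
    last = Fin.fromℕ n

-- For positive b the set function lands in ℤ≥0, its intended codomain.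
cap-nonneg : ∀ {n} (b : Vector ℕ n) → (∀ i → 0 ℕ.< b i) → ∀ I → 0ℤ ℤ.≤ cap b I
cap-nonneg b 0<b I with nonempty? I
... | no  _ = ℤ.≤-refl
... | yes _ = subst (0ℤ ℤ.≤_) (ℤ.+-comm (+ s) (ℤ.- (+ ∣ I ∣)))
                (ℤ.i≤j⇒0≤j-i (ℤ.+≤+ (size≤sum b 0<b (∣p∣≤n I))))
  where s = sumℕ (λ k → (∣ I ∣ ⊓ suc (toℕ k)) ℕ.* b (opposite k))

{-# OPTIONS --safe #-}

-- cap b I = h ∣ I ∣ with h m = − m + Σₖ min(m, k+1) bₙ₋ₖ.  Each m ↦ min(m, k+1) is
-- concave, hence so is h, and concavity of h is submodularity of I ↦ h ∣ I ∣.
module Submission where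

open import Defs
import Algebra.Properties.CommutativeMonoid.Sum as CommutativeMonoidSum
import Algebra.Properties.Group as GroupProperties
open import Data.Fin.Base using (Fin; zero; suc; toℕ; opposite)
open import Data.Fin.Subset using (Subset; ∣_∣; _∪_; ⁅_⁆; _∉_; inside; outside)
open import Data.Fin.Subset.Properties
  using (nonempty?; Empty-unique; ∣⊥∣≡0; ∪-identityʳ; p⊆q⇒∣p∣≤∣q∣)
open import Data.Integer.Base as ℤ using (ℤ; +_; -[1+_]; 1ℤ)
import Data.Integer.Properties as ℤ
open import Data.Integer.Tactic.RingSolver using (solve-∀)
open import Data.Nat.Base as ℕ using (ℕ; zero; suc; NonZero; _⊓_; z≤n; s≤s)
import Data.Nat.Coprimality as Coprime
import Data.Nat.Properties as ℕ
open import Data.Product.Base using (_×_; _,_)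
open import Data.Rational.Base as ℚ using (mkℚ; *≤*)
import Data.Rational.Properties as ℚ
open import Data.Vec.Base using (_∷_; here; there)
open import Data.Vec.Functional using (Vector)
open import Function.Base using (id; _∘_)
open import Relation.Binary.PropositionalEquality
open import Relation.Nullary.Decidable.Core using (yes; no)
open import Relation.Nullary.Negation.Core using (¬_; contradiction)
open import Relation.Unary using (_≐_)

open GroupProperties ℚ.+-0-group using (⁻¹-involutive)
open CommutativeMonoidSum ℕ.+-0-commutativeMonoid using (sum; ∑-distrib-+; sum-replicate-zero)

-- Adding an element to a set of size m changes `cap b` by `capOfSize b (suc m)` minus
-- `capOfSize b m`, so submodularity says that these increments do not grow with m. The linear part
-- contributes -1 to every increment, and the rest is a combination of truncations min(m, j) with
-- weights from b; each truncation rises by 1 until j and is then flat (`⊓-concave`). The empty set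
-- needs `cap≡capOfSize`: its prescribed value 0 agrees with the formula. The inequality is proved
-- in the integers and carried to the reals along constant sequences.

i/1≡mkℚ : ∀ i → i ℚ./ 1 ≡ mkℚ i 0 (Coprime.sym (Coprime.1-coprimeTo ℤ.∣ i ∣))
i/1≡mkℚ i = ℚ.fromℚᵘ-toℚᵘ (mkℚ i 0 _)

/1-mono-≤ : ∀ {i j} → i ℤ.≤ j → i ℚ./ 1 ℚ.≤ j ℚ./ 1
-- The gcd inside `_/_` is stuck on a variable numerator; the rewrite exposes denominator 1.
/1-mono-≤ {i} {j} i≤j rewrite i/1≡mkℚ i | i/1≡mkℚ j = *≤* (ℤ.*-monoʳ-≤-nonNeg 1ℤ i≤j)

/1-homo-+ : ∀ i j → (i ℚ./ 1) ℚ.+ (j ℚ./ 1) ≡ (i ℤ.+ j) ℚ./ 1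
/1-homo-+ i j rewrite i/1≡mkℚ i | i/1≡mkℚ j =
  cong (ℚ._/ 1) (cong₂ ℤ._+_ (ℤ.*-identityʳ i) (ℤ.*-identityʳ j))

/1-homo-neg : ∀ i → ℚ.- (i ℚ./ 1) ≡ (ℤ.- i) ℚ./ 1
/1-homo-neg (+ zero)  = refl
/1-homo-neg (+ suc _) = refl
/1-homo-neg -[1+ n ]  = ⁻¹-involutive (+ suc n ℚ./ 1)

/1-homo-- : ∀ i j → (i ℚ./ 1) ℚ.- (j ℚ./ 1) ≡ (i ℤ.- j) ℚ./ 1
/1-homo-- i j = trans (cong (i ℚ./ 1 ℚ.+_) (/1-homo-neg j)) (/1-homo-+ i (ℤ.- j))

fromℤ-diff-mono-≤ : ∀ {i j k l} → i ℤ.- j ℤ.≤ k ℤ.- l → fromℤ i - fromℤ j ≤ fromℤ k - fromℤ l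
fromℤ-diff-mono-≤ {i} {j} {k} {l} i-j≤k-l ε 0<ε = 0 , λ _ _ → begin
  (i ℚ./ 1) ℚ.- (j ℚ./ 1)         ≡⟨ /1-homo-- i j ⟩
  (i ℤ.- j) ℚ./ 1                 ≤⟨ /1-mono-≤ i-j≤k-l ⟩
  (k ℤ.- l) ℚ./ 1                 ≡⟨ /1-homo-- k l ⟨
  k-l                             ≡⟨ ℚ.+-identityʳ k-l ⟨
  k-l ℚ.+ ℚ.0ℚ                    ≤⟨ ℚ.+-monoʳ-≤ k-l (ℚ.<⇒≤ 0<ε) ⟩
  k-l ℚ.+ ε                       ∎
  where
  open ℚ.≤-Reasoning
  k-l = (k ℚ./ 1) ℚ.- (l ℚ./ 1)

-- Decreasing increments, with the subtracted terms moved across to avoid truncated subtraction. The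
-- induction lowers m, l and k together until m or k is 0.
⊓-concave : ∀ {m l} k → m ℕ.≤ l → (suc l ⊓ k) ℕ.+ (m ⊓ k) ℕ.≤ (suc m ⊓ k) ℕ.+ (l ⊓ k)
⊓-concave {m} {l} zero _ = ℕ.≤-reflexive (trans (ℕ.⊓-zeroʳ m) (sym (ℕ.⊓-zeroʳ l)))
⊓-concave {l = l} (suc k) z≤n = begin
  suc (l ⊓ k) ℕ.+ 0    ≡⟨ ℕ.+-identityʳ _ ⟩
  suc (l ⊓ k)          ≤⟨ s≤s (ℕ.⊓-monoʳ-≤ l (ℕ.n≤1+n k)) ⟩
  suc (l ⊓ suc k)      ∎
  where open ℕ.≤-Reasoning
⊓-concave (suc k) (s≤s {m} {l} m≤l) = s≤s (begin
  (suc l ⊓ k) ℕ.+ suc (m ⊓ k)    ≡⟨ ℕ.+-suc (suc l ⊓ k) (m ⊓ k) ⟩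
  suc ((suc l ⊓ k) ℕ.+ (m ⊓ k))  ≤⟨ s≤s (⊓-concave k m≤l) ⟩
  suc ((suc m ⊓ k) ℕ.+ (l ⊓ k))  ≡⟨ ℕ.+-suc (suc m ⊓ k) (l ⊓ k) ⟨
  (suc m ⊓ k) ℕ.+ suc (l ⊓ k)    ∎)
  where open ℕ.≤-Reasoning

sum-mono-≤ : ∀ {n} {s t : Vector ℕ n} → (∀ i → s i ℕ.≤ t i) → sum s ℕ.≤ sum t
sum-mono-≤ {zero}  s≤t = z≤n
sum-mono-≤ {suc n} s≤t = ℕ.+-mono-≤ (s≤t zero) (sum-mono-≤ (s≤t ∘ suc))

module _ {n} (b : Vector ℕ n) where

  term : ℕ → Vector ℕ n
  term m k = (m ⊓ suc (toℕ k)) ℕ.* b (opposite k)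

  -- Concavity survives sums with nonnegative weights, here the entries of b.
  total-concave : ∀ {m l} → m ℕ.≤ l →
    sum (term (suc l)) ℕ.+ sum (term m) ℕ.≤ sum (term (suc m)) ℕ.+ sum (term l)
  total-concave {m} {l} m≤l = begin
    sum (term (suc l)) ℕ.+ sum (term m)      ≡⟨ ∑-distrib-+ (term (suc l)) (term m) ⟨
    sum (λ k → term (suc l) k ℕ.+ term m k)  ≤⟨ sum-mono-≤ term-concave ⟩
    sum (λ k → term (suc m) k ℕ.+ term l k)  ≡⟨ ∑-distrib-+ (term (suc m)) (term l) ⟩
    sum (term (suc m)) ℕ.+ sum (term l)      ∎
    where
    open ℕ.≤-Reasoning
    term-concave : ∀ k → term (suc l) k ℕ.+ term m k ℕ.≤ term (suc m) k ℕ.+ term l k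
    term-concave k = begin
      term (suc l) k ℕ.+ term m k                        ≡⟨ ℕ.*-distribʳ-+ bₖ (suc l ⊓ j) (m ⊓ j) ⟨
      ((suc l ⊓ j) ℕ.+ (m ⊓ j)) ℕ.* bₖ                   ≤⟨ ℕ.*-monoˡ-≤ bₖ (⊓-concave j m≤l) ⟩
      ((suc m ⊓ j) ℕ.+ (l ⊓ j)) ℕ.* bₖ                   ≡⟨ ℕ.*-distribʳ-+ bₖ (suc m ⊓ j) (l ⊓ j) ⟩
      term (suc m) k ℕ.+ term l k                        ∎
      where
      j = suc (toℕ k)
      bₖ = b (opposite k)

  capOfSize : ℕ → ℤ
  capOfSize m = ℤ.- (+ m) ℤ.+ (+ sum (term m))

  capOfSize-concave : ∀ {m l} → m ℕ.≤ l →
    capOfSize (suc l) ℤ.- capOfSize l ℤ.≤ capOfSize (suc m) ℤ.- capOfSize m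
  capOfSize-concave {m} {l} m≤l = begin
    capOfSize (suc l) ℤ.- capOfSize l
      -- Adding and subtracting `S m` turns the difference into the left side of `total-concave`
      -- minus `d`, which is symmetric in l and m up to commutativity.
      ≡⟨ increment (+ l) (+ S (suc l)) (+ S l) (+ S m) ⟩
    (+ (S (suc l) ℕ.+ S m)) ℤ.- d
      ≤⟨ ℤ.+-monoˡ-≤ (ℤ.- d) (ℤ.+≤+ (total-concave m≤l)) ⟩
    (+ (S (suc m) ℕ.+ S l)) ℤ.- d
      ≡⟨ cong (λ e → + (S (suc m) ℕ.+ S l) ℤ.- (1ℤ ℤ.+ e)) (ℤ.+-comm (+ S l) (+ S m)) ⟩
    (+ (S (suc m) ℕ.+ S l)) ℤ.- (1ℤ ℤ.+ (+ S m ℤ.+ + S l))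
      ≡⟨ increment (+ m) (+ S (suc m)) (+ S m) (+ S l) ⟨
    capOfSize (suc m) ℤ.- capOfSize m ∎
    where
    open ℤ.≤-Reasoning
    S : ℕ → ℕ
    S = sum ∘ term
    d = 1ℤ ℤ.+ (+ S l ℤ.+ + S m)
    increment : ∀ x s t u → (ℤ.- (1ℤ ℤ.+ x) ℤ.+ s) ℤ.- (ℤ.- x ℤ.+ t) ≡ (s ℤ.+ u) ℤ.- (1ℤ ℤ.+ (t ℤ.+ u))
    increment = solve-∀

  cap≡capOfSize : ∀ I → cap b I ≡ capOfSize ∣ I ∣
  cap≡capOfSize I with nonempty? I
  ... | yes _ = refl
  -- At size 0 every min(0, j) vanishes, so the formula also yields the default 0.
  ... | no ∄x rewrite Empty-unique ∄x | ∣⊥∣≡0 n = sym (cong +_ (sum-replicate-zero n))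

∣p∪⁅x⁆∣≡1+∣p∣ : ∀ {n} (p : Subset n) {x} → x ∉ p → ∣ p ∪ ⁅ x ⁆ ∣ ≡ suc ∣ p ∣
∣p∪⁅x⁆∣≡1+∣p∣ (inside  ∷ p) {zero}  x∉p = contradiction here x∉p
∣p∪⁅x⁆∣≡1+∣p∣ (outside ∷ p) {zero}  x∉p = cong (suc ∘ ∣_∣) (∪-identityʳ p)
∣p∪⁅x⁆∣≡1+∣p∣ (inside  ∷ p) {suc x} x∉p = cong suc (∣p∪⁅x⁆∣≡1+∣p∣ p (x∉p ∘ there))
∣p∪⁅x⁆∣≡1+∣p∣ (outside ∷ p) {suc x} x∉p = ∣p∪⁅x⁆∣≡1+∣p∣ p (x∉p ∘ there)

-- Since z lies in neither X nor Y, both sides are increments of `capOfSize b`, at sizes ordered by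
-- the inclusion.
cap-submodular : ∀ {n} (b : Vector ℕ n) → Submodular (λ I → fromℤ (cap b I))
cap-submodular b X Y z X⊆Y z∉Y = fromℤ-diff-mono-≤ {cap b (Y ∪ ⁅ z ⁆)} {cap b Y} {cap b (X ∪ ⁅ z ⁆)} {cap b X}
  (subst₂ ℤ._≤_ (sym (cap-increment Y z∉Y)) (sym (cap-increment X (z∉Y ∘ X⊆Y)))
    (capOfSize-concave b (p⊆q⇒∣p∣≤∣q∣ X⊆Y)))
  where
  cap-increment : ∀ I → z ∉ I →
    cap b (I ∪ ⁅ z ⁆) ℤ.- cap b I ≡ capOfSize b (suc ∣ I ∣) ℤ.- capOfSize b ∣ I ∣
  cap-increment I z∉I = cong₂ ℤ._-_
    (trans (cap≡capOfSize b (I ∪ ⁅ z ⁆)) (cong (capOfSize b) (∣p∪⁅x⁆∣≡1+∣p∣ I z∉I)))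
    (cap≡capOfSize b I)

cap-cong-∣∣ : ∀ {n} (b : Vector ℕ n) (I J : Subset n) → ∣ I ∣ ≡ ∣ J ∣ → cap b I ≡ cap b J
cap-cong-∣∣ b I J ∣I∣≡∣J∣ =
  trans (cap≡capOfSize b I) (trans (cong (capOfSize b) ∣I∣≡∣J∣) (sym (cap≡capOfSize b J)))

theorem4p3 : ∀ (n : ℕ) → .{{_ : NonZero n}} → (b : Vector ℕ n) → (∀ i → 0 ℕ.< b i) →
    ¬ (n ≡ 1 × (∀ i → b i ≡ 1)) →
    Submodular (λ I → fromℤ (cap b I)) ×
    𝔛′ b ≐ polymatroid (λ I → fromℤ (cap b I)) ×
    (∀ (I J : Subset n) → ∣ I ∣ ≡ ∣ J ∣ → cap b I ≡ cap b J)
-- Both predicates unfold to the same inequalities, so `id` gives each inclusion.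
theorem4p3 n b _ _ = cap-submodular b , (id , id) , cap-cong-∣∣ b
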